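{- Consider the following two multi-round rectangle packing games on $U=[0,1]^2$ between Alice and Bob. In each round $i$, Alice places a point $s_i\in[0,1]^2$ outside of Bob's previously chosen rectangles, and then Bob chooses an axis-aligned rectangle $r_i\subseteq[0,1]^2$ with lower left corner $s_i$, interior-disjoint from his previous rectangles; Alice must place the origin $(0,0)$ in some round. In the $n$-round game the number $n$ of rounds is known to both players in advance; in the unlimited game the number of rounds is not known in advance and the game ends after the round in which Alice places the origin. Bob's greedy strategy is to choose, in each round, a rectangle $r_i$ of maximum area among all admissible rectangles. Then in both versions, the greedy strategy cannot guarantee Bob any positive constant covered area: for every $\varepsilon>0$ Alice can play (in the $n$-round game for a suitable $n$, and in the unlimited game) a finite sequence of points such that the total area of Bob's greedy rectangles is at most $\varepsilon$.
   Formalization: Points, rectangles and ε are taken with rational instead of real values; in particular Bob's greedy rectangle has maximum area among admissible rectangles with rational corners. -}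

module Defs where

open import Data.Rational using (ℚ; 0ℚ; 1ℚ; _≤_; _<_; _*_; _+_; _-_)
open import Data.List using (List; []; _∷_; foldr)
open import Data.List.Relation.Unary.All using (All)
open import Data.Product using (_×_)
open import Relation.Nullary using (¬_)
open import Relation.Binary.PropositionalEquality using (_≡_)

record Pt : Set where
  constructor pt
  field
    px py : ℚ
open Pt public

origin : Pt
origin = pt 0ℚ 0ℚ

record Rect : Set where
  constructor rect
  field
    x₁ y₁ x₂ y₂ : ℚ
open Rect public

InU : Pt → Set
InU s = (0ℚ ≤ px s × px s ≤ 1ℚ) × (0ℚ ≤ py s × py s ≤ 1ℚ)

RectInU : Rect → Set
RectInU r = (0ℚ ≤ x₁ r × x₁ r ≤ x₂ r × x₂ r ≤ 1ℚ)
          × (0ℚ ≤ y₁ r × y₁ r ≤ y₂ r × y₂ r ≤ 1ℚ)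

InRect : Pt → Rect → Set
InRect s r = (x₁ r ≤ px s × px s ≤ x₂ r) × (y₁ r ≤ py s × py s ≤ y₂ r)

InteriorsMeet : Rect → Rect → Set
InteriorsMeet r r' =
  (x₁ r < x₂ r × x₁ r' < x₂ r' × y₁ r < y₂ r × y₁ r' < y₂ r')
  × (x₁ r < x₂ r' × x₁ r' < x₂ r × y₁ r < y₂ r' × y₁ r' < y₂ r)

InteriorDisjoint : Rect → Rect → Set
InteriorDisjoint r r' = ¬ InteriorsMeet r r'

area : Rect → ℚ
area r = (x₂ r - x₁ r) * (y₂ r - y₁ r)

totalArea : List Rect → ℚ
totalArea = foldr (λ r a → area r + a) 0ℚ

Admissible : Pt → List Rect → Rect → Set
Admissible s prev r =
  (x₁ r ≡ px s × y₁ r ≡ py s) × RectInU r × All (InteriorDisjoint r) prev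

Greedy : Pt → List Rect → Rect → Set
Greedy s prev r = Admissible s prev r × (∀ r' → Admissible s prev r' → area r' ≤ area r)

LegalPt : Pt → List Rect → Set
LegalPt s prev = InU s × All (λ r → ¬ InRect s r) prev

-- An (adaptive) strategy for Alice: given Bob's rectangles so far
-- (most recent first), the next point.
Strategy : Set
Strategy = List Rect → Pt

-- Histories (most recent rectangle first) reachable when Alice plays σ
-- and Bob plays greedily (with arbitrary tie-breaking).
data GreedyRun (σ : Strategy) : List Rect → Set where
  start : GreedyRun σ []
  step  : ∀ {h r} → GreedyRun σ h → Greedy (σ h) h r → GreedyRun σ (r ∷ h)

{-# OPTIONS --safe #-}

-- Call a rectangle R "open" if it is free and every rectangle that Bob may anchor in it
-- stays below its top and left of its right side.  By induction, Alice can play inside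
-- any open R so that Bob's answers have total area at most C |R| and the last answer is
-- a wall: a rectangle at the left side of R, of full height.  For C = 1 she plays the
-- lower left corner.  To lower C, she cuts R, from right to left, into n columns hanging
-- from the top; in relative coordinates the p-th one begins at abscissa 2^-p, and its
-- bottom is at half the height of the hyperbola xy = A := 2^-n over its right side.  She
-- plays recursively in each column (the wall of a column keeps the next one open), then at
-- the corner of R.  A rectangle anchored there that reaches beyond the leftmost column wall
-- has area less than A |R|, so Bob takes the wall of relative width A.  The columns leave
-- out the relative area A + nA/4, so C becomes C (1 - A - nA/4) + A, which is at most
-- C - εA if C ≥ ε and nε ≥ 4.
module Submission where

open import Defs
open import Data.Empty using (⊥-elim)
open import Data.Integer using (+_; +[1+_])
import Data.Integer as ℤ
import Data.Integer.Properties as ℤ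
open import Data.List using (List; []; _∷_; length)
open import Data.List.Membership.Propositional using (_∈_)
open import Data.List.Relation.Unary.All using (All; lookup; tabulate)
open import Data.List.Relation.Unary.Any using (here; there)
open import Data.Nat using (ℕ; zero; suc; s≤s) renaming (_<_ to _<ℕ_; _≤_ to _≤ℕ_; _+_ to _+ℕ_; _*_ to _*ℕ_)
import Data.Nat.Properties as ℕ
open import Data.Product using (Σ; _×_; _,_; proj₁; proj₂)
open import Data.Rational using (ℚ; 0ℚ; 1ℚ; ½; _≤_; _<_; _+_; _*_; _-_; -_; _/_; mkℚ; *<*; toℚᵘ; nonNegative; positive)
open import Data.Rational.Properties
open import Data.Rational.Solver
import Data.Rational.Unnormalised as ℚᵘ
import Data.Rational.Unnormalised.Properties as ℚᵘ
open import Data.Sum using (_⊎_; inj₁; inj₂)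
open import Relation.Binary.PropositionalEquality using (_≡_; _≢_; refl; sym; trans; cong; cong₂; subst; subst₂)
open import Relation.Nullary using (¬_; yes; no)
open +-*-Solver

-- Rational arithmetic

≤-by-difference : ∀ {p q} d → 0ℚ ≤ d → q ≡ p + d → p ≤ q
≤-by-difference {p} d 0≤d refl = subst (_≤ p + d) (+-identityʳ p) (+-monoʳ-≤ p 0≤d)

<-by-difference : ∀ {p q} d → 0ℚ < d → q ≡ p + d → p < q
<-by-difference {p} d 0<d refl = subst (_< p + d) (+-identityʳ p) (+-monoʳ-< p 0<d)

p≤q⇒0≤q-p : ∀ {p q} → p ≤ q → 0ℚ ≤ q - p
p≤q⇒0≤q-p {p} {q} p≤q = subst (_≤ q - p) (+-inverseʳ p) (+-monoˡ-≤ (- p) p≤q)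

p<q⇒0<q-p : ∀ {p q} → p < q → 0ℚ < q - p
p<q⇒0<q-p {p} {q} p<q = subst (_< q - p) (+-inverseʳ p) (+-monoˡ-< (- p) p<q)

0≤p*q : ∀ {p q} → 0ℚ ≤ p → 0ℚ ≤ q → 0ℚ ≤ p * q
0≤p*q {p} {q} 0≤p 0≤q = subst (_≤ p * q) (*-zeroˡ q) (*-monoʳ-≤-nonNeg q {{nonNegative 0≤q}} 0≤p)

0<p*q : ∀ {p q} → 0ℚ < p → 0ℚ < q → 0ℚ < p * q
0<p*q {p} {q} 0<p 0<q = subst (_< p * q) (*-zeroˡ q) (*-monoˡ-<-pos q {{positive 0<q}} 0<p)

*-mono-≤ : ∀ {p q r s} → 0ℚ ≤ r → 0ℚ ≤ q → p ≤ q → r ≤ s → p * r ≤ q * s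
*-mono-≤ {p} {q} {r} {s} 0≤r 0≤q p≤q r≤s =
  ≤-trans (*-monoʳ-≤-nonNeg r {{nonNegative 0≤r}} p≤q) (*-monoˡ-≤-nonNeg q {{nonNegative 0≤q}} r≤s)

<⇒≱ : ∀ {p q} → p < q → ¬ q ≤ p
<⇒≱ p<q q≤p = <-irrefl refl (<-≤-trans p<q q≤p)

0<1 : 0ℚ < 1ℚ
0<1 = positive⁻¹ 1ℚ

0≤1 : 0ℚ ≤ 1ℚ
0≤1 = <⇒≤ 0<1

0<½ : 0ℚ < ½
0<½ = positive⁻¹ ½

fromℕ : ℕ → ℚ
fromℕ n = + n / 1

fromℕ-suc : ∀ n → fromℕ (suc n) ≡ 1ℚ + fromℕ n
fromℕ-suc n = toℚᵘ-injective (begin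
  toℚᵘ (fromℕ (suc n))            ≈⟨ toℚᵘ-fromℚᵘ (ℚᵘ.mkℚᵘ (+ suc n) 0) ⟩
  ℚᵘ.mkℚᵘ (+ suc n) 0              ≡⟨ cong (λ i → ℚᵘ.mkℚᵘ (+ 1 ℤ.+ i) 0) (sym (ℤ.*-identityʳ (+ n))) ⟩
  ℚᵘ.1ℚᵘ ℚᵘ.+ ℚᵘ.mkℚᵘ (+ n) 0      ≈⟨ ℚᵘ.+-congʳ ℚᵘ.1ℚᵘ (ℚᵘ.≃-sym (toℚᵘ-fromℚᵘ (ℚᵘ.mkℚᵘ (+ n) 0))) ⟩
  ℚᵘ.1ℚᵘ ℚᵘ.+ toℚᵘ (fromℕ n)      ≈⟨ ℚᵘ.≃-sym (toℚᵘ-homo-+ 1ℚ (fromℕ n)) ⟩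
  toℚᵘ (1ℚ + fromℕ n)             ∎)
  where open ℚᵘ.≃-Reasoning

0≤fromℕ : ∀ n → 0ℚ ≤ fromℕ n
0≤fromℕ zero    = ≤-refl
0≤fromℕ (suc n) = subst (0ℚ ≤_) (sym (fromℕ-suc n))
  (≤-trans (0≤fromℕ n) (≤-by-difference 1ℚ 0≤1 (+-comm 1ℚ (fromℕ n))))

-- The denominator of `p` serves as `n`: the product is then the numerator, a positive integer.
archimedean : ∀ p → 0ℚ < p → Σ ℕ λ n → 1ℚ ≤ fromℕ n * p
archimedean (mkℚ (+ zero) d _)   (*<* (ℤ.+<+ ()))
archimedean (mkℚ (ℤ.-[1+ _ ]) d _) (*<* ())
archimedean p@(mkℚ +[1+ k ] d _) _ = suc d , toℚᵘ-cancel-≤ (begin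
  ℚᵘ.1ℚᵘ                              ≤⟨ ℚᵘ.*≤* (ℤ.+≤+ denominator≤) ⟩
  ℚᵘ.mkℚᵘ (+ suc d) 0 ℚᵘ.* toℚᵘ p      ≃⟨ ℚᵘ.*-congʳ (ℚᵘ.≃-sym (toℚᵘ-fromℚᵘ (ℚᵘ.mkℚᵘ (+ suc d) 0))) ⟩
  toℚᵘ (fromℕ (suc d)) ℚᵘ.* toℚᵘ p    ≃⟨ ℚᵘ.≃-sym (toℚᵘ-homo-* (fromℕ (suc d)) p) ⟩
  toℚᵘ (fromℕ (suc d) * p)            ∎)
  where
  open ℚᵘ.≤-Reasoning
  denominator≤ : 1 *ℕ (1 *ℕ suc d) ≤ℕ (suc d *ℕ suc k) *ℕ 1
  denominator≤ = subst₂ _≤ℕ_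
    (sym (trans (ℕ.*-identityˡ (1 *ℕ suc d)) (ℕ.*-identityˡ (suc d))))
    (sym (ℕ.*-identityʳ (suc d *ℕ suc k)))
    (ℕ.m≤m*n (suc d) (suc k))

-- Games

_⊑_ : Rect → Rect → Set
r ⊑ R = (x₁ R ≤ x₁ r × x₂ r ≤ x₂ R) × (y₁ R ≤ y₁ r × y₂ r ≤ y₂ R)

Proper : Rect → Set
Proper r = x₁ r < x₂ r × y₁ r < y₂ r

corner : Rect → Pt
corner r = pt (x₁ r) (y₁ r)

-- The left and lower sides count because Alice plays lower left corners. The right side does not:
-- Bob's rectangles are closed, and an earlier wall may begin there.
InHalfOpen : Pt → Rect → Set
InHalfOpen s R = (x₁ R ≤ px s × px s < x₂ R) × (y₁ R ≤ py s × py s < y₂ R)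

-- `unique` ranges over all greedy answers, which covers every way of breaking ties.
record Forced (h : List Rect) (r : Rect) : Set where
  field
    proper : Proper r
    legal  : LegalPt (corner r) h
    unique : ∀ r' → Greedy (corner r) h r' → r' ≡ r

data Forces (h : List Rect) : List Rect → Set where
  done : Forces h h
  _▸_  : ∀ {g r} → Forces h g → Forced g r → Forces h (r ∷ g)

Forces-trans : ∀ {f g h} → Forces f g → Forces g h → Forces f h
Forces-trans p done    = p
Forces-trans p (q ▸ s) = Forces-trans p q ▸ s

Forces⇒⊆ : ∀ {g h} → Forces g h → ∀ {r} → r ∈ g → r ∈ h
Forces⇒⊆ done    r∈ = r∈
Forces⇒⊆ (p ▸ _) r∈ = there (Forces⇒⊆ p r∈)

Forces⇒length≤ : ∀ {g h} → Forces g h → length g ≤ℕ length h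
Forces⇒length≤ done    = ℕ.≤-refl
Forces⇒length≤ (p ▸ _) = ℕ.m≤n⇒m≤1+n (Forces⇒length≤ p)

Forces-sameLength : ∀ {g h} → Forces g h → length g ≡ length h → g ≡ h
Forces-sameLength done    _  = refl
Forces-sameLength (p ▸ _) eq = ⊥-elim (ℕ.<⇒≢ (s≤s (Forces⇒length≤ p)) eq)

-- Areas and forced answers

area-zeroˣ : ∀ r → x₂ r ≡ x₁ r → area r ≡ 0ℚ
area-zeroˣ (rect x y₁ _ y₂) refl = solve 3 (λ x y z → (x :- x) :* (z :- y) := con 0ℚ) refl x y₁ y₂

area-zeroʸ : ∀ r → y₂ r ≡ y₁ r → area r ≡ 0ℚ
area-zeroʸ (rect x₁ y x₂ _) refl = solve 3 (λ x y z → (z :- x) :* (y :- y) := con 0ℚ) refl x₁ y x₂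

area-positive : ∀ {r} → Proper r → 0ℚ < area r
area-positive (x< , y<) = 0<p*q (p<q⇒0<q-p x<) (p<q⇒0<q-p y<)

proper-if-area-positive : ∀ {r} → RectInU r → 0ℚ < area r → Proper r
proper-if-area-positive {r} ((_ , x≤ , _) , (_ , y≤ , _)) 0<area =
  ≰⇒> (λ p → <⇒≢ 0<area (sym (area-zeroˣ r (≤-antisym p x≤)))) , ≰⇒> (λ p → <⇒≢ 0<area (sym (area-zeroʸ r (≤-antisym p y≤))))

shift-monoˡ-≤ : ∀ c {p q} → p ≤ q → p - c ≤ q - c
shift-monoˡ-≤ c = +-monoˡ-≤ (- c)

shift-monoˡ-< : ∀ c {p q} → p < q → p - c < q - c
shift-monoˡ-< c = +-monoˡ-< (- c)

-- If one side of the inner rectangle were strictly shorter, its area would be strictly smaller,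
-- since its other side is positive and no longer than that of the box.
largest-in-box : ∀ {a c x y w d} → a < x → c < y → x ≤ w → y ≤ d →
  area (rect a c w d) ≤ area (rect a c x y) → rect a c x y ≡ rect a c w d
largest-in-box {a} {c} {x} {y} {w} {d} a<x c<y x≤w y≤d area≤ =
  cong₂ (rect a c) (≤-antisym x≤w (≮⇒≥ λ x<w → <⇒≱ (narrower x<w) area≤))
                   (≤-antisym y≤d (≮⇒≥ λ y<d → <⇒≱ (lower y<d) area≤))
  where
  0<x-a = p<q⇒0<q-p a<x
  0<y-c = p<q⇒0<q-p c<y
  narrower : x < w → area (rect a c x y) < area (rect a c w d)
  narrower x<w = <-≤-trans (*-monoˡ-<-pos (y - c) {{positive 0<y-c}} (shift-monoˡ-< a x<w))
    (*-monoˡ-≤-nonNeg (w - a) {{nonNegative (p≤q⇒0≤q-p (≤-trans (<⇒≤ a<x) x≤w))}} (shift-monoˡ-≤ c y≤d))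
  lower : y < d → area (rect a c x y) < area (rect a c w d)
  lower y<d = <-≤-trans (*-monoʳ-<-pos (x - a) {{positive 0<x-a}} (shift-monoˡ-< c y<d))
    (*-monoʳ-≤-nonNeg (d - c) {{nonNegative (p≤q⇒0≤q-p (≤-trans (<⇒≤ c<y) y≤d))}} (shift-monoˡ-≤ a x≤w))

-- A greedy answer has at least the positive area of `F`, so it is proper and the bound applies. The
-- second alternative, for wide but low rectangles, contradicts greediness; in the first the answer
-- fits into `F` and therefore fills it.
forced-wall : ∀ {h F} → Proper F → LegalPt (corner F) h → Admissible (corner F) h F →
  (∀ r → Admissible (corner F) h r → Proper r →
    y₂ r ≤ y₂ F × (x₂ r ≤ x₂ F ⊎ area r < area F)) →
  Forced h F
forced-wall {h} {F} proper legal admissible bound = record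
  { proper = proper ; legal = legal ; unique = unique }
  where
  unique : ∀ r → Greedy (corner F) h r → r ≡ F
  unique r@(rect _ _ x y) (adm@((refl , refl) , inU , _) , largest)
    with proper-if-area-positive inU (<-≤-trans (area-positive proper) (largest F admissible))
  ... | prop@(a<x , c<y) with bound r adm prop
  ... | y≤d , inj₁ x≤w = largest-in-box a<x c<y x≤w y≤d (largest F admissible)
  ... | _   , inj₂ lt  = ⊥-elim (<⇒≱ lt (largest F admissible))

-- Open rectangles and achievable constants

Confined : List Rect → Rect → Set
Confined h R = ∀ r → InHalfOpen (corner r) R → Proper r → RectInU r →
  All (InteriorDisjoint r) h → x₂ r ≤ x₂ R × y₂ r ≤ y₂ R

record Open (h : List Rect) (R : Rect) : Set where
  field
    clear    : ∀ {r} → r ∈ h → ∀ s → InHalfOpen s R → ¬ InRect s r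
    free     : ∀ {r} → r ∈ h → InteriorDisjoint R r
    confined : Confined h R

-- The width of the wall is left unspecified: any positive width blocks rectangles coming from the
-- left. By `new`, the play leaves the board outside `R` as it was.
record Outcome (C : ℚ) (h : List Rect) (R : Rect) : Set where
  field
    end      : ℚ
    properly : x₁ R < end
  wall : Rect
  wall = rect (x₁ R) (y₁ R) end (y₂ R)
  field
    {history} : List Rect
    play  : Forces h (wall ∷ history)
    new   : ∀ {r} → r ∈ wall ∷ history → r ∈ h ⊎ r ⊑ R
    total : totalArea (wall ∷ history) ≤ totalArea h + C * area R

Achievable : ℚ → Set
Achievable C = ∀ {h R} → RectInU R → Proper R → Open h R → Outcome C h R

legal-corner : ∀ {h R} → RectInU R →
  (∀ {r} → r ∈ h → ¬ InRect (corner R) r) → LegalPt (corner R) h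
legal-corner ((0≤a , a≤b , b≤1) , (0≤c , c≤d , d≤1)) clear =
  ((0≤a , ≤-trans a≤b b≤1) , (0≤c , ≤-trans c≤d d≤1)) , tabulate clear

corner∈ : ∀ {R} → Proper R → InHalfOpen (corner R) R
corner∈ (a<b , c<d) = (≤-refl , a<b) , (≤-refl , c<d)

achievable-1 : Achievable 1ℚ
achievable-1 {h} {R@(rect a c b d)} inU proper@(a<b , c<d) open' = record
  { end = b ; properly = a<b
  ; play = done ▸ forced-wall proper
      (legal-corner {R = R} inU (λ r∈ → clear r∈ _ (corner∈ proper)))
      ((refl , refl) , inU , tabulate free)
      (λ { r ((refl , refl) , inU' , disj) prop →
           let x≤ , y≤ = confined r (corner∈ proper) prop inU' disj in y≤ , inj₁ x≤ })
  ; new = λ { (here refl) → inj₂ ((≤-refl , ≤-refl) , (≤-refl , ≤-refl)) ; (there r∈) → inj₁ r∈ }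
  ; total = ≤-reflexive (solve 2 (λ s t → s :+ t := t :+ con 1ℚ :* s) refl (area R) (totalArea h))
  }
  where open Open open'

achievable-mono : ∀ {C D} → C ≤ D → Achievable C → Achievable D
achievable-mono {C} {D} C≤D ach {h} {R} inU proper open' = record
  { end = end ; properly = properly ; play = play ; new = new
  ; total = ≤-trans total (+-monoʳ-≤ (totalArea h)
      (*-monoʳ-≤-nonNeg (area R) {{nonNegative (<⇒≤ (area-positive proper))}} C≤D)) }
  where open Outcome (ach inU proper open')

-- Columns

2^- : ℕ → ℚ
2^- zero    = 1ℚ
2^- (suc p) = ½ * 2^- p

0<2^- : ∀ p → 0ℚ < 2^- p
0<2^- zero    = 0<1
0<2^- (suc p) = 0<p*q 0<½ (0<2^- p)

2^-suc< : ∀ p → 2^- (suc p) < 2^- p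
2^-suc< p = <-by-difference (½ * 2^- p) (0<2^- (suc p))
  (solve 1 (λ e → e := con ½ :* e :+ con ½ :* e) refl (2^- p))

2^-≤1 : ∀ p → 2^- p ≤ 1ℚ
2^-≤1 zero    = ≤-refl
2^-≤1 (suc p) = ≤-trans (<⇒≤ (2^-suc< p)) (2^-≤1 p)

2^-+ : ∀ p k → 2^- (p +ℕ k) ≡ 2^- p * 2^- k
2^-+ zero    k = sym (*-identityˡ (2^- k))
2^-+ (suc p) k = trans (cong (½ *_) (2^-+ p k)) (sym (*-assoc ½ (2^- p) (2^- k)))

along : ℚ → ℚ → ℚ → ℚ
along a b e = a + (b - a) * e

module _ {a b} (a<b : a < b) where

  along-< : ∀ {e f} → e < f → along a b e < along a b f
  along-< e<f = +-monoʳ-< a (*-monoʳ-<-pos (b - a) {{positive (p<q⇒0<q-p a<b)}} e<f)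

  along-≤ : ∀ {e f} → e ≤ f → along a b e ≤ along a b f
  along-≤ e≤f = +-monoʳ-≤ a (*-monoˡ-≤-nonNeg (b - a) {{nonNegative (p≤q⇒0≤q-p (<⇒≤ a<b))}} e≤f)

  along-0 : along a b 0ℚ ≡ a
  along-0 = solve 2 (λ a b → a :+ (b :- a) :* con 0ℚ := a) refl a b

  along-1 : along a b 1ℚ ≡ b
  along-1 = solve 2 (λ a b → a :+ (b :- a) :* con 1ℚ := b) refl a b

  <along : ∀ {e} → 0ℚ < e → a < along a b e
  <along {e} 0<e = subst (_< along a b e) along-0 (along-< 0<e)

  along≤ : ∀ {e} → e ≤ 1ℚ → along a b e ≤ b
  along≤ {e} e≤1 = subst (along a b e ≤_) along-1 (along-≤ e≤1)

  along< : ∀ {e} → e < 1ℚ → along a b e < b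
  along< {e} e<1 = subst (along a b e <_) along-1 (along-< e<1)

⊑-trans : ∀ {p q r} → p ⊑ q → q ⊑ r → p ⊑ r
⊑-trans ((p , p') , (p'' , p''')) ((q , q') , (q'' , q''')) =
  (≤-trans q p , ≤-trans p' q') , (≤-trans q'' p'' , ≤-trans p''' q''')

InteriorsMeet-mono : ∀ {q R} r → Proper R → q ⊑ R → InteriorsMeet q r → InteriorsMeet R r
InteriorsMeet-mono r (a<b , c<d) ((a≤ , ≤b) , (c≤ , ≤d)) ((_ , rx , _ , ry) , (p , p' , p'' , p''')) =
  (a<b , rx , c<d , ry) , (≤-<-trans a≤ p , <-≤-trans p' ≤b , ≤-<-trans c≤ p'' , <-≤-trans p''' ≤d)

InHalfOpen-mono : ∀ {s q R} → q ⊑ R → InHalfOpen s q → InHalfOpen s R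
InHalfOpen-mono ((a≤ , ≤b) , (c≤ , ≤d)) ((p , p') , (p'' , p''')) =
  (≤-trans a≤ p , <-≤-trans p' ≤b) , (≤-trans c≤ p'' , <-≤-trans p''' ≤d)

RectInU-mono : ∀ {q R} → RectInU R → Proper q → q ⊑ R → RectInU q
RectInU-mono ((0≤a , _ , b≤1) , (0≤c , _ , d≤1)) (x< , y<) ((a≤ , ≤b) , (c≤ , ≤d)) =
  (≤-trans 0≤a a≤ , <⇒≤ x< , ≤-trans ≤b b≤1) , (≤-trans 0≤c c≤ , <⇒≤ y< , ≤-trans ≤d d≤1)

disjoint-from-earlier : ∀ {g h r} → Forces g h → All (InteriorDisjoint r) h → All (InteriorDisjoint r) g
disjoint-from-earlier play disjoint = tabulate λ r∈ → lookup disjoint (Forces⇒⊆ play r∈)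

module Columns {C : ℚ} (achievable : Achievable C) {h : List Rect} {a c b d : ℚ} (n : ℕ)
  (inU : RectInU (rect a c b d)) (proper : Proper (rect a c b d)) (open' : Open h (rect a c b d)) where

  R : Rect
  R = rect a c b d

  a<b : a < b
  a<b = proj₁ proper

  c<d : c < d
  c<d = proj₂ proper

  -- For `suc p + k = n` the hyperbola has relative height 2^-n / 2^-p = 2^-(k+1) over the right
  -- side `X p`; `Y k` is half of that. Indexing by the number `k` of later columns avoids
  -- subtraction.
  X Y : ℕ → ℚ
  X p = along a b (2^- p)
  Y k = along c d (2^- (2 +ℕ k))

  wall : Rect
  wall = rect a c (X n) d

  a<X : ∀ p → a < X p
  a<X p = <along a<b (0<2^- p)

  X≤b : ∀ p → X p ≤ b
  X≤b p = along≤ a<b (2^-≤1 p)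

  Xsuc<X : ∀ p → X (suc p) < X p
  Xsuc<X p = along-< a<b (2^-suc< p)

  c<Y : ∀ k → c < Y k
  c<Y k = <along c<d (0<2^- (2 +ℕ k))

  Y<d : ∀ k → Y k < d
  Y<d k = along< c<d (<-≤-trans (2^-suc< (suc k)) (2^-≤1 (suc k)))

  Ysuc<Y : ∀ k → Y (suc k) < Y k
  Ysuc<Y k = along-< c<d (2^-suc< (2 +ℕ k))

  column : ℕ → ℕ → Rect
  column p k = rect (X (suc p)) (Y k) (X p) d

  column⊑ : ∀ p k → column p k ⊑ R
  column⊑ p k = (<⇒≤ (a<X (suc p)) , X≤b p) , (<⇒≤ (c<Y k) , ≤-refl)

  column-proper : ∀ p k → Proper (column p k)
  column-proper p k = Xsuc<X p , Y<d k

  -- The part below the column has relative width 2^-(p+1) and height 2^-(2+k). The exponents add up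
  -- to `2 + n`, so every column leaves out the same area.
  area-column : ∀ p k → suc p +ℕ k ≡ n → area (column p k) ≡ area R * (2^- (suc p) - 2^- (2 +ℕ n))
  area-column p k refl = trans
    (solve 6 (λ a b c d e f →
       ((a :+ (b :- a) :* e) :- (a :+ (b :- a) :* (con ½ :* e)))
         :* (d :- (c :+ (d :- c) :* (con ½ :* (con ½ :* f))))
       := ((b :- a) :* (d :- c)) :* (con ½ :* e :- con ½ :* (con ½ :* ((con ½ :* e) :* f)))) refl a b c d (2^- p) (2^- k))
    (cong (λ e → area R * (2^- (suc p) - ½ * (½ * e))) (sym (2^-+ (suc p) k)))

  -- The exponents `p` and `2 + k` add up to `n + 1`, so the left side is exactly half the area of
  -- the wall.
  under-staircase<area-wall : ∀ p k → suc p +ℕ k ≡ n → (X p - a) * (Y k - c) < area wall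
  under-staircase<area-wall p k refl = <-by-difference (½ * (area R * 2^- n))
    (0<p*q 0<½ (0<p*q (area-positive proper) (0<2^- n)))
    (subst (λ e → (along a b e - a) * (d - c) ≡ (X p - a) * (Y k - c) + ½ * (area R * e)) (sym (2^-+ (suc p) k))
      (solve 6 (λ a b c d e f → ((a :+ (b :- a) :* ((con ½ :* e) :* f)) :- a) :* (d :- c)
         := ((a :+ (b :- a) :* e) :- a) :* ((c :+ (d :- c) :* (con ½ :* (con ½ :* f))) :- c)
            :+ con ½ :* (((b :- a) :* (d :- c)) :* ((con ½ :* e) :* f))) refl a b c d (2^- p) (2^- k)))

  -- The state of the game after p columns, when k = n - p are left.
  record Stage (p k : ℕ) : Set where
    field
      history  : List Rect
      play     : Forces h history
      new      : ∀ {r} → r ∈ history → r ∈ h ⊎ (r ⊑ R × X p ≤ x₁ r)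
      confined : Confined history (rect a (Y k) (X p) d)
      bound    : ∀ r → Admissible (pt a c) history r → Proper r → x₂ r ≤ X p ⊎ area r < area wall
      total    : totalArea history ≤ totalArea h + C * (area R * ((1ℚ - 2^- p) - fromℕ p * 2^- (2 +ℕ n)))

  first : Stage 0 n
  first = record
    { history = h ; play = done ; new = inj₁
    ; confined = λ r r∈ prop rInU disjoint →
        let x≤ , y≤ = Open.confined open' r
              (InHalfOpen-mono {corner r} {rect a (Y n) (X 0) d} {R} ((≤-refl , X≤b 0) , (<⇒≤ (c<Y n) , ≤-refl)) r∈)
              prop rInU disjoint
        in ≤-trans x≤ b≤X0 , y≤
    ; bound = λ { r ((refl , refl) , rInU , disjoint) prop →
        inj₁ (≤-trans (proj₁ (Open.confined open' r (corner∈ proper) prop rInU disjoint)) b≤X0) }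
    ; total = ≤-reflexive (solve 4 (λ t C s e → t := t :+ C :* (s :* ((con 1ℚ :- con 1ℚ) :- con 0ℚ :* e))) refl
        (totalArea h) C (area R) (2^- (2 +ℕ n)))
    }
    where
    b≤X0 : b ≤ X 0
    b≤X0 = ≤-reflexive (sym (along-1 a<b))

  -- A rectangle on the board either precedes the play in `R`, where openness of `R` applies, or
  -- lies to the right of `X p`, the right side of the column. Confinement is inherited from the
  -- larger region left of `X p`.
  column-open : ∀ {p k} (stage : Stage p (suc k)) → Open (Stage.history stage) (column p k)
  column-open {p} {k} stage = record { clear = clear ; free = free ; confined = λ r r∈ →
      S.confined r (InHalfOpen-mono {corner r} {column p k} ((<⇒≤ (a<X (suc p)) , ≤-refl) , (<⇒≤ (Ysuc<Y k) , ≤-refl)) r∈) }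
    where
    module S = Stage stage
    clear : ∀ {r} → r ∈ S.history → ∀ s → InHalfOpen s (column p k) → ¬ InRect s r
    clear r∈ s s∈ s∈r with S.new r∈
    ... | inj₁ r∈h      = Open.clear open' r∈h s (InHalfOpen-mono {s} {column p k} (column⊑ p k) s∈) s∈r
    ... | inj₂ (_ , X≤) = <⇒≱ (proj₂ (proj₁ s∈)) (≤-trans X≤ (proj₁ (proj₁ s∈r)))
    free : ∀ {r} → r ∈ S.history → InteriorDisjoint (column p k) r
    free {r} r∈ meet with S.new r∈
    ... | inj₁ r∈h      = Open.free open' r∈h (InteriorsMeet-mono {column p k} r proper (column⊑ p k) meet)
    ... | inj₂ (_ , X≤) = <⇒≱ (proj₁ (proj₂ (proj₂ meet))) X≤

  extend : ∀ {p k} → suc p +ℕ k ≡ n → (stage : Stage p (suc k)) →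
    Outcome C (Stage.history stage) (column p k) → Stage (suc p) k
  extend {p} {k} eq stage columnOutcome = record
    { history = O.wall ∷ O.history ; play = Forces-trans S.play O.play
    ; new = new ; confined = confined ; bound = bound ; total = total }
    where
    module S = Stage stage
    module O = Outcome columnOutcome

    new : ∀ {r} → r ∈ O.wall ∷ O.history → r ∈ h ⊎ (r ⊑ R × X (suc p) ≤ x₁ r)
    new {r} r∈ with O.new r∈
    ... | inj₂ r⊑ = inj₂ (⊑-trans {r} {column p k} {R} r⊑ (column⊑ p k) , proj₁ (proj₁ r⊑))
    ... | inj₁ r∈S with S.new r∈S
    ...   | inj₁ r∈h       = inj₁ r∈h
    ...   | inj₂ (r⊑ , X≤) = inj₂ (r⊑ , ≤-trans (<⇒≤ (Xsuc<X p)) X≤)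

    confined : Confined (O.wall ∷ O.history) (rect a (Y k) (X (suc p)) d)
    confined r r∈@((a≤ , <X) , (Y≤ , <d)) prop@(x< , y<) rInU disjoint =
      -- The new wall begins at `X (suc p)` and spans the heights from `Y k` to `d`, so a rectangle
      -- starting at such a height cannot cross it.
      ≮⇒≥ (λ X<x₂ → lookup disjoint (here refl)
        ((x< , O.properly , y< , Y<d k) , (<-trans <X O.properly , X<x₂ , <d , ≤-<-trans Y≤ y<)))
      , proj₂ (S.confined r
          (InHalfOpen-mono {corner r} {rect a (Y k) (X (suc p)) d} ((≤-refl , <⇒≤ (Xsuc<X p)) , (<⇒≤ (Ysuc<Y k) , ≤-refl)) r∈)
          prop rInU (disjoint-from-earlier O.play disjoint))

    bound : ∀ r → Admissible (pt a c) (O.wall ∷ O.history) r → Proper r → x₂ r ≤ X (suc p) ⊎ area r < area wall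
    bound r (corner≡@(refl , refl) , rInU , disjoint) prop@(x< , y<)
      with S.bound r (corner≡ , rInU , disjoint-from-earlier O.play disjoint) prop
    ... | inj₂ small = inj₂ small
    ... | inj₁ x≤X with x₂ r ≤? X (suc p)
    ...   | yes x≤X' = inj₁ x≤X'
    -- Beyond `X (suc p)` the rectangle must pass below the new wall, hence under `Y k`, while the
    -- previous bound keeps it left of `X p`.
    ...   | no  x≰X' = inj₂ (≤-<-trans
            (*-mono-≤ (p≤q⇒0≤q-p (<⇒≤ y<)) (p≤q⇒0≤q-p (<⇒≤ (a<X p))) (shift-monoˡ-≤ a x≤X)
              (shift-monoˡ-≤ c (≮⇒≥ λ Y<y₂ → lookup disjoint (here refl)
                ((x< , O.properly , y< , Y<d k) , (<-trans (a<X (suc p)) O.properly , ≰⇒> x≰X' , c<d , Y<y₂)))))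
            (under-staircase<area-wall p k eq))

    total : totalArea (O.wall ∷ O.history) ≤
      totalArea h + C * (area R * ((1ℚ - 2^- (suc p)) - fromℕ (suc p) * 2^- (2 +ℕ n)))
    -- The column widths telescope, and one more quarter of 2^-n is left out.
    total = ≤-trans O.total (≤-trans (+-monoˡ-≤ (C * area (column p k)) S.total) (≤-reflexive
      (trans (cong (λ s → totalArea h + C * (area R * ((1ℚ - 2^- p) - fromℕ p * 2^- (2 +ℕ n))) + C * s)
               (area-column p k eq))
        (trans (solve 6 (λ t C s e f z →
            (t :+ C :* (s :* ((con 1ℚ :- e) :- f :* z))) :+ C :* (s :* (con ½ :* e :- z))
            := t :+ C :* (s :* ((con 1ℚ :- con ½ :* e) :- (con 1ℚ :+ f) :* z)))
            refl (totalArea h) C (area R) (2^- p) (fromℕ p) (2^- (2 +ℕ n)))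
          (cong (λ f → totalArea h + C * (area R * ((1ℚ - 2^- (suc p)) - f * 2^- (2 +ℕ n)))) (sym (fromℕ-suc p)))))))

  next : ∀ {p k} → suc p +ℕ k ≡ n → Stage p (suc k) → Stage (suc p) k
  next {p} {k} eq stage = extend eq stage
    (achievable (RectInU-mono {column p k} inU (column-proper p k) (column⊑ p k))
      (column-proper p k) (column-open stage))

  last : ∀ k p → p +ℕ k ≡ n → Stage p k → Stage n 0
  last zero    p eq stage = subst (λ i → Stage i 0) (trans (sym (ℕ.+-identityʳ p)) eq) stage
  last (suc k) p eq stage = last k (suc p) eq' (next eq' stage)
    where eq' = trans (sym (ℕ.+-suc p k)) eq

  finish : ∀ {ε} → ε ≤ C → 1ℚ ≤ fromℕ n * (½ * (½ * ε)) → Stage n 0 → Outcome (C - ε * 2^- n) h R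
  finish {ε} ε≤C 1≤nε/4 stage = record
    { end = X n ; properly = a<X n
    ; play = S.play ▸ forced-wall wall-proper
        (legal-corner wallInU clear)
        ((refl , refl) , wallInU , tabulate free)
        (λ { r adm@((refl , refl) , rInU , disjoint) prop →
          proj₂ (Open.confined open' r (corner∈ proper) prop rInU (disjoint-from-earlier S.play disjoint))
          , S.bound r adm prop })
    ; new = new
    ; total = ≤-trans (+-monoʳ-≤ (area wall) S.total) (≤-by-difference
        -- The slack, split into three terms that are nonnegative by ε ≤ C and nε/4 ≥ 1.
        (area R * 2^- n * ((C - ε) + ((fromℕ n * (½ * (½ * ε)) - 1ℚ) + fromℕ n * (½ * (½ * (C - ε))))))
        (0≤p*q (<⇒≤ (0<p*q (area-positive proper) (0<2^- n)))
          (+-mono-≤ 0≤C-ε (+-mono-≤ (p≤q⇒0≤q-p 1≤nε/4)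
            (0≤p*q (0≤fromℕ n) (0≤p*q (<⇒≤ 0<½) (0≤p*q (<⇒≤ 0<½) 0≤C-ε))))))
        (solve 9 (λ a b c d t C ε e f →
            t :+ (C :- ε :* e) :* ((b :- a) :* (d :- c))
            := (((a :+ (b :- a) :* e) :- a) :* (d :- c)
              :+ (t :+ C :* (((b :- a) :* (d :- c)) :* ((con 1ℚ :- e) :- f :* (con ½ :* (con ½ :* e))))))
              :+ ((b :- a) :* (d :- c)) :* e
                :* ((C :- ε) :+ ((f :* (con ½ :* (con ½ :* ε)) :- con 1ℚ) :+ f :* (con ½ :* (con ½ :* (C :- ε))))))
          refl a b c d (totalArea h) C ε (2^- n) (fromℕ n)))
    }
    where
    module S = Stage stage
    0≤C-ε : 0ℚ ≤ C - ε
    0≤C-ε = p≤q⇒0≤q-p ε≤C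
    wall-proper : Proper wall
    wall-proper = a<X n , c<d
    wall⊑ : wall ⊑ R
    wall⊑ = (≤-refl , X≤b n) , (≤-refl , ≤-refl)
    wallInU : RectInU wall
    wallInU = RectInU-mono {wall} inU wall-proper wall⊑
    clear : ∀ {r} → r ∈ S.history → ¬ InRect (pt a c) r
    clear r∈ in-r with S.new r∈
    ... | inj₁ r∈h      = Open.clear open' r∈h _ (corner∈ proper) in-r
    ... | inj₂ (_ , X≤) = <⇒≱ (a<X n) (≤-trans X≤ (proj₁ (proj₁ in-r)))
    free : ∀ {r} → r ∈ S.history → InteriorDisjoint wall r
    free {r} r∈ meet with S.new r∈
    ... | inj₁ r∈h      = Open.free open' r∈h (InteriorsMeet-mono {wall} r proper wall⊑ meet)
    ... | inj₂ (_ , X≤) = <⇒≱ (proj₁ (proj₂ (proj₂ meet))) X≤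
    new : ∀ {r} → r ∈ wall ∷ S.history → r ∈ h ⊎ r ⊑ R
    new (here refl) = inj₂ wall⊑
    new (there r∈) with S.new r∈
    ... | inj₁ r∈h      = inj₁ r∈h
    ... | inj₂ (r⊑ , _) = inj₂ r⊑

-- Descent of the constant

achievable-step : ∀ {C ε} n → ε ≤ C → 1ℚ ≤ fromℕ n * (½ * (½ * ε)) → Achievable C → Achievable (C - ε * 2^- n)
achievable-step n ε≤C 1≤nε/4 achievable inU proper open' = finish ε≤C 1≤nε/4 (last n 0 refl first)
  where open Columns achievable n inU proper open'

-- As long as the constant is at least `ε`, the same `n` works, so each step lowers it by the fixed
-- amount `ε * 2^- n`.
achievable-descent : ∀ {ε} n → 0ℚ < ε → 1ℚ ≤ fromℕ n * (½ * (½ * ε)) →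
  ∀ j → Achievable (ε + fromℕ j * (ε * 2^- n)) → Achievable ε
achievable-descent {ε} n 0<ε 1≤nε/4 zero    ach =
  subst Achievable (solve 2 (λ e t → e :+ con 0ℚ :* t := e) refl ε (ε * 2^- n)) ach
achievable-descent {ε} n 0<ε 1≤nε/4 (suc j) ach = achievable-descent n 0<ε 1≤nε/4 j
  (subst Achievable
    (trans (cong (λ f → (ε + f * (ε * 2^- n)) - ε * 2^- n) (fromℕ-suc j))
      (solve 3 (λ e f t → (e :+ (con 1ℚ :+ f) :* t) :- t := e :+ f :* t) refl ε (fromℕ j) (ε * 2^- n)))
    (achievable-step {ε = ε} n
      (≤-by-difference _ (0≤p*q (0≤fromℕ (suc j)) (<⇒≤ (0<p*q 0<ε (0<2^- n)))) refl) 1≤nε/4 ach))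

achievable-positive : ∀ ε → 0ℚ < ε → Achievable ε
achievable-positive ε 0<ε =
  -- `n` is large enough for a step at level `ε`; `j` steps then suffice to descend from 1.
  let n , 1≤nε/4 = archimedean (½ * (½ * ε)) (0<p*q 0<½ (0<p*q 0<½ 0<ε))
      j , 1≤jt   = archimedean (ε * 2^- n) (0<p*q 0<ε (0<2^- n))
  in achievable-descent n 0<ε 1≤nε/4 j
       (achievable-mono (≤-trans 1≤jt (≤-by-difference ε (<⇒≤ 0<ε) (+-comm ε _))) achievable-1)

-- Alice's strategy

-- The most recent rectangle comes first, so the move of round `i`, counted from 0, is the corner of
-- the entry whose tail has length `i`. Past the end of the script the value defaults to `origin`.
cornerAt : List Rect → ℕ → Pt
cornerAt []      _ = origin
cornerAt (r ∷ L) i with i ℕ.≟ length L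
... | yes _ = corner r
... | no  _ = cornerAt L i

cornerAt-length : ∀ r L → cornerAt (r ∷ L) (length L) ≡ corner r
cornerAt-length r L with length L ℕ.≟ length L
... | yes _ = refl
... | no ≢  = ⊥-elim (≢ refl)

Forces-next : ∀ {h L} → Forces h L → length h <ℕ length L →
  Σ Rect λ r → Forced h r × Forces (r ∷ h) L × cornerAt L (length h) ≡ corner r
Forces-next done lt = ⊥-elim (ℕ.<-irrefl refl lt)
Forces-next {h} (_▸_ {g} {r} play forced) lt with length h ℕ.≟ length g
-- Equal lengths identify `g` with `h`, so `r` is the very next rectangle.
... | yes eq with refl ← Forces-sameLength play eq = r , forced , done , refl
... | no  ≢ =
  let r' , forced' , play' , eq = Forces-next play (ℕ.≤∧≢⇒< (Forces⇒length≤ play) ≢)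
  in r' , forced' , play' ▸ forced , eq

-- By induction on the run: the scripted move is forced, so Bob's greedy answer is the scripted one.
-- Thus Alice's moves need only the round number.
greedyRun-follows : ∀ {L h} → Forces [] L → GreedyRun (λ g → cornerAt L (length g)) h →
  length h ≤ℕ length L → Forces h L
greedyRun-follows play start _ = play
greedyRun-follows {L} play (step {g} {r} run greedy) le
  with r' , forced , play' , eq ← Forces-next (greedyRun-follows play run (ℕ.<⇒≤ le)) le
  = subst (λ q → Forces (q ∷ g) L) (sym (Forced.unique forced r (subst (λ s → Greedy s g r) eq greedy))) play'

-- Play in the unit square

unitSquare : Rect
unitSquare = rect 0ℚ 0ℚ 1ℚ 1ℚ

unitSquare-open : Open [] unitSquare
unitSquare-open = record
  { clear = λ () ; free = λ ()
  ; confined = λ { _ _ _ ((_ , _ , x≤1) , (_ , _ , y≤1)) _ → x≤1 , y≤1 } }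

module Script {ε : ℚ} (outcome : Outcome ε [] unitSquare) where

  open Outcome outcome

  L : List Rect
  L = wall ∷ history

  σ : Strategy
  σ h = cornerAt L (length h)

  legal : ∀ h → GreedyRun σ h → length h ≤ℕ length history → LegalPt (σ h) h
  legal h run le
    with r , forced , _ , eq ← Forces-next (greedyRun-follows play run (ℕ.m≤n⇒m≤1+n le)) (s≤s le)
    = subst (λ s → LegalPt s h) (sym eq) (Forced.legal forced)

  wall-forced : ∀ {g} → Forces g L → length g <ℕ length L → Forces g history × Forced history wall
  wall-forced done     lt = ⊥-elim (ℕ.<-irrefl refl lt)
  wall-forced (p ▸ f) _  = p , f

  -- An earlier rectangle anchored at the origin would make Alice's last point illegal.
  not-yet : ∀ h → GreedyRun σ h → length h <ℕ length history → σ h ≢ origin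
  not-yet h run lt σh≡origin
    with r , forced , play' , eq ← Forces-next (greedyRun-follows play run (ℕ.m≤n⇒m≤1+n (ℕ.<⇒≤ lt))) (ℕ.m≤n⇒m≤1+n lt)
    with earlier , forced-origin ← wall-forced play' (s≤s lt)
    = lookup (proj₂ (Forced.legal forced-origin)) (Forces⇒⊆ earlier (here refl))
        (subst (λ s → InRect s r) (trans (sym eq) σh≡origin)
          ((≤-refl , <⇒≤ (proj₁ (Forced.proper forced))) , (≤-refl , <⇒≤ (proj₂ (Forced.proper forced)))))

  finally : ∀ h → GreedyRun σ h → length h ≡ length history → σ h ≡ origin
  -- The last wall shares its lower left corner with the unit square.
  finally h _ eq = trans (cong (cornerAt L) eq) (cornerAt-length wall history)

  small : ∀ h → GreedyRun σ h → length h ≡ suc (length history) → totalArea h ≤ ε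
  small h run eq with refl ← Forces-sameLength (greedyRun-follows play run (ℕ.≤-reflexive eq)) eq =
    subst (totalArea L ≤_)
      (solve 1 (λ e → con 0ℚ :+ e :* ((con 1ℚ :- con 0ℚ) :* (con 1ℚ :- con 0ℚ)) := e) refl ε)
      total

theorem2 : (ε : ℚ) → 0ℚ < ε →
    Σ ℕ λ m → Σ Strategy λ σ →
    (∀ h → GreedyRun σ h → length h ≤ℕ m → LegalPt (σ h) h)
    × (∀ h → GreedyRun σ h → length h <ℕ m → σ h ≢ origin)
    × (∀ h → GreedyRun σ h → length h ≡ m → σ h ≡ origin)
    × (∀ h → GreedyRun σ h → length h ≡ suc m → totalArea h ≤ ε)
-- The script has one rectangle more than `history`, namely the final wall, so this length is the
-- index of the last round.
theorem2 ε 0<ε = length (Outcome.history outcome) , σ , legal , not-yet , finally , small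
  where
  outcome : Outcome ε [] unitSquare
  outcome = achievable-positive ε 0<ε
    ((≤-refl , 0≤1 , ≤-refl) , (≤-refl , 0≤1 , ≤-refl)) (0<1 , 0<1) unitSquare-open
  open Script outcome
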